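{- For any star $S$ and any $n$-vertex graph $H$, $$\mathrm{gm}(S\cdot H)\leq 2\sqrt{n( \mathrm{tw}(H) +1)}.$$
   Context: For a graph $G$, $\mathrm{gm}(G)$ is the maximum integer $k$ such that the $k\times k$ grid is a minor of $G$, and $\mathrm{tw}(G)$ is the treewidth of $G$. $G_1\cdot G_2$ denotes the lexicographic product: vertex set $V(G_1)\times V(G_2)$, where distinct $(u_1,u_2),(v_1,v_2)$ are adjacent iff $u_1v_1\in E(G_1)$, or $u_1=v_1$ and $u_2v_2\in E(G_2)$. -}

module Defs where

open import Data.Nat using (ℕ; zero; suc; _+_; _*_; _≤_)
open import Data.Fin using (Fin; toℕ)
open import Data.Fin.Subset using (Subset; _∈_; ∣_∣)
open import Data.Product using (Σ; ∃; ∃-syntax; _×_; _,_)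
open import Data.Sum using (_⊎_; inj₁; inj₂)
open import Data.Maybe using (Maybe; just)
open import Data.Empty using (⊥)
open import Relation.Nullary using (¬_)
open import Relation.Binary.PropositionalEquality using (_≡_; _≢_; refl; sym)

record Graph : Set₁ where
  field
    V      : Set
    E      : V → V → Set
    E-sym  : ∀ {u v} → E u v → E v u
    E-irr  : ∀ {u} → ¬ E u u
open Graph public

data WalkIn {A : Set} (R : A → A → Set) (P : A → Set) : A → A → Set where
  here : ∀ {u} → P u → WalkIn R P u u
  step : ∀ {u v w} → P u → R u v → WalkIn R P v w → WalkIn R P u w

-- Minors: a minor model of H in G.  β v = just h means v lies in the
-- branch set of h; β v = nothing means v is deleted.  Branch sets are
-- automatically pairwise disjoint; they are required to be nonempty and
-- connected, and every edge of H is realised by an edge of G between the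
-- corresponding branch sets.

record MinorModel (H G : Graph) : Set where
  field
    β         : V G → Maybe (V H)
    nonempty  : ∀ h → ∃[ v ] (β v ≡ just h)
    connected : ∀ h u v → β u ≡ just h → β v ≡ just h →
                WalkIn (E G) (λ x → β x ≡ just h) u v
    adjacent  : ∀ h h' → E H h h' →
                ∃[ u ] ∃[ v ] (β u ≡ just h × β v ≡ just h' × E G u v)

_≼_ : Graph → Graph → Set
H ≼ G = MinorModel H G

Adj1 : ∀ {k} → Fin k → Fin k → Set
Adj1 a b = suc (toℕ a) ≡ toℕ b ⊎ suc (toℕ b) ≡ toℕ a

private
  Adj1-sym : ∀ {k} {a b : Fin k} → Adj1 a b → Adj1 b a
  Adj1-sym (inj₁ p) = inj₂ p
  Adj1-sym (inj₂ p) = inj₁ p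

  n≢sn : ∀ n → suc n ≢ n
  n≢sn zero ()
  n≢sn (suc n) p = n≢sn n (cong-pred p)
    where
    cong-pred : ∀ {a b} → suc a ≡ suc b → a ≡ b
    cong-pred refl = refl

  Adj1-irr : ∀ {k} {a : Fin k} → ¬ Adj1 a a
  Adj1-irr {a = a} (inj₁ p) = n≢sn (toℕ a) p
  Adj1-irr {a = a} (inj₂ p) = n≢sn (toℕ a) p

GridE : ∀ {k} → Fin k × Fin k → Fin k × Fin k → Set
GridE (i , j) (i' , j') = (i ≡ i' × Adj1 j j') ⊎ (j ≡ j' × Adj1 i i')

Grid : ℕ → Graph
Grid k = record
  { V = Fin k × Fin k
  ; E = GridE
  ; E-sym = λ { (inj₁ (p , a)) → inj₁ (sym p , Adj1-sym a)
              ; (inj₂ (p , a)) → inj₂ (sym p , Adj1-sym a) }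
  ; E-irr = λ { (inj₁ (_ , a)) → Adj1-irr a ; (inj₂ (_ , a)) → Adj1-irr a }
  }

IsGridMinorNumber : Graph → ℕ → Set
IsGridMinorNumber G g = (Grid g ≼ G) × (∀ k → Grid k ≼ G → k ≤ g)

StarE : ∀ {m} → Fin (suc m) → Fin (suc m) → Set
StarE i j = (i ≡ Fin.zero × j ≢ Fin.zero) ⊎ (j ≡ Fin.zero × i ≢ Fin.zero)

Star : ℕ → Graph
Star m = record
  { V = Fin (suc m)
  ; E = StarE
  ; E-sym = λ { (inj₁ (p , q)) → inj₂ (p , q) ; (inj₂ (p , q)) → inj₁ (p , q) }
  ; E-irr = λ { (inj₁ (p , q)) → q p ; (inj₂ (p , q)) → q p }
  }

LexE : (G₁ G₂ : Graph) → V G₁ × V G₂ → V G₁ × V G₂ → Set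
LexE G₁ G₂ (u₁ , u₂) (v₁ , v₂) = E G₁ u₁ v₁ ⊎ (u₁ ≡ v₁ × E G₂ u₂ v₂)

_·_ : Graph → Graph → Graph
G₁ · G₂ = record
  { V = V G₁ × V G₂
  ; E = LexE G₁ G₂
  ; E-sym = λ { (inj₁ e) → inj₁ (E-sym G₁ e)
              ; (inj₂ (p , e)) → inj₂ (sym p , E-sym G₂ e) }
  ; E-irr = λ { (inj₁ e) → E-irr G₁ e ; (inj₂ (_ , e)) → E-irr G₂ e }
  }

-- Trees, presented on node set Fin (suc t) by a parent function:
-- node suc i has parent parent i, whose index is at most i.  Every finite
-- tree has such a labelling (e.g. BFS order) and every such structure is
-- a tree.

record Tree : Set where
  field
    t        : ℕ
    parent   : Fin t → Fin (suc t)
    parent≤  : ∀ i → toℕ (parent i) ≤ toℕ i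
open Tree public

TreeE : (T : Tree) → Fin (suc (t T)) → Fin (suc (t T)) → Set
TreeE T a b = (∃[ i ] (a ≡ Fin.suc i × b ≡ parent T i))
            ⊎ (∃[ i ] (b ≡ Fin.suc i × a ≡ parent T i))

record FinGraph (n : ℕ) : Set₁ where
  field
    Adj      : Fin n → Fin n → Set
    Adj-sym  : ∀ {u v} → Adj u v → Adj v u
    Adj-irr  : ∀ {u} → ¬ Adj u u
open FinGraph public

⟦_⟧ : ∀ {n} → FinGraph n → Graph
⟦ H ⟧ = record { V = Fin _ ; E = Adj H ; E-sym = Adj-sym H ; E-irr = Adj-irr H }

record TreeDecomposition {n : ℕ} (H : FinGraph n) : Set where
  field
    tree      : Tree
    bag       : Fin (suc (t tree)) → Subset n
    covers-V  : ∀ v → ∃[ x ] (v ∈ bag x)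
    covers-E  : ∀ u v → Adj H u v → ∃[ x ] (u ∈ bag x × v ∈ bag x)
    subtree   : ∀ v x y → v ∈ bag x → v ∈ bag y →
                WalkIn (TreeE tree) (λ z → v ∈ bag z) x y
open TreeDecomposition public

WidthAtMost : ∀ {n} {H : FinGraph n} → TreeDecomposition H → ℕ → Set
WidthAtMost D w = ∀ x → ∣ bag D x ∣ ≤ suc w

IsTreewidth : ∀ {n} → FinGraph n → ℕ → Set
IsTreewidth H w =
  (∃[ D ] WidthAtMost {H = H} D w) ×
  (∀ (D : TreeDecomposition H) w' → WidthAtMost D w' → w ≤ w')

{-# OPTIONS --safe #-}

-- Branch sets meeting the root copy of H delete at most n vertices of the k × k
-- grid, and what remains of each connected piece lives in a single leaf copy of H.
-- Hence a p × p cell of the grid that loses x vertices satisfies p ≤ tw + x, by the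
-- bramble of order p + 1, and p² ≤ n + p x, by counting vertices of the leaf copy.
-- Summing over q² disjoint cells, of which r² can be enlarged to side p + 1 when
-- k = q p + r, gives q² p + r² ≤ n + q² tw and q² p² ≤ q² n + p n; the choice of q
-- with p close to 2 (tw + 1) gives k² ≤ 4 n (tw + 1).

module Submission where

-- No tree decomposition of the product is built. The bramble members that avoid the root copy touch
-- pairwise, so they lie in one common leaf copy, and a single bag of `H` hits them all. Rounding is
-- the obstacle. If `k = q p` exactly, `q² (p - tw) ≤ n` reads `n ≥ k² (p - tw) / p²`; for positive
-- `tw` the best choice `p = 2 tw` would give `k² ≤ 4 n tw`. Having `tw + 1` instead of `tw` in the
-- claim is what pays for rounding `k / q`. Put `W = tw + 1`. Two savings, a bramble whose order
-- exceeds the side of the cell by one and the `r²` enlarged cells, make the cell bound sufficient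
-- whenever `(k - 2 W q)² ≤ 3 W q²`. When `q` is small compared with `W`, consecutive multiples of
-- `2 W` can both be too far from `k / q` scaled up to `k`. The size bound then takes over: it reads
-- `n ≥ q² p² / (q² + p)`, and for `q = ⌊k / 2W⌋ + 1` the denominator is below `10 W / 3`. The gap
-- between `10 / 3` and `4` absorbs the rounding.

open import Defs
open import Data.Nat as ℕ using (ℕ; zero; suc; _+_; _*_; _∸_; _/_; _%_; _≤_; _<_; z≤n; s≤s; NonZero; >-nonZero)
import Data.Nat.DivMod as ℕ
import Data.Nat.Properties as ℕ
open import Data.Nat.Tactic.RingSolver using (solve-∀)
open import Data.Fin using (Fin; zero; suc; toℕ; fromℕ<; remQuot; combine)
import Data.Fin.Properties as Fin
open import Data.Fin.Subset using (Subset; inside; outside; _∈_; ∣_∣)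
open import Data.Fin.Subset.Properties using (_∈?_)
open import Data.List using (List; []; _∷_; _++_; length; lookup; map; filter; mapMaybe; allFin; cartesianProductWith)
open import Data.List.Extrema.Nat using (argmax; f[xs]≤f[argmax])
open import Data.List.Membership.Propositional using (find; lose) renaming (_∈_ to _∈ˡ_)
open import Data.List.Membership.Propositional.Properties
  using (∈-allFin; ∈-map⁺; ∈-filter⁺; ∈-cartesianProductWith⁺; ∈-++⁺ˡ; ∈-++⁺ʳ)
import Data.List.Properties as List
import Data.List.Relation.Unary.All as All
open import Data.List.Relation.Unary.Any as Any using (Any; here; there)
import Data.List.Relation.Unary.Any.Properties as Any
open import Data.Maybe as Maybe using (Maybe; just; nothing)
import Data.Maybe.Relation.Unary.Any as MAny
open import Data.Product using (Σ; ∃; ∃-syntax; _×_; _,_; proj₁; proj₂)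
open import Data.Sum using (_⊎_; inj₁; inj₂; swap)
open import Data.Vec using ([]; _∷_; here; there)
open import Function using (_∘_; id; case_of_)
open import Relation.Binary.PropositionalEquality
open import Relation.Nullary using (¬_; Dec; yes; no; contradiction)
open import Relation.Nullary.Decidable using (¬?; _×-dec_; _⊎-dec_; decidable-stable; map′)
open import Relation.Unary using (Decidable; _⊆_; _∪_)

-- Walks

walk-image : ∀ {A B : Set} {R : A → A → Set} {R' : B → B → Set} {P : A → Set} {P' : B → Set} (f : A → B) →
             (∀ {u v} → R u v → R' (f u) (f v)) → (∀ {u} → P u → P' (f u)) →
             ∀ {u v} → WalkIn R P u v → WalkIn R' P' (f u) (f v)
walk-image f r q (here p)     = here (q p)
walk-image f r q (step p e w) = step (q p) (r e) (walk-image f r q w)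

module _ {A : Set} {R : A → A → Set} where

  walk-map : {P Q : A → Set} → P ⊆ Q → ∀ {u v} → WalkIn R P u v → WalkIn R Q u v
  walk-map = walk-image id id

  infixr 5 _⧺_
  _⧺_ : {P : A → Set} → ∀ {u v w} → WalkIn R P u v → WalkIn R P v w → WalkIn R P u w
  here _       ⧺ w = w
  step p e w'  ⧺ w = step p e (w' ⧺ w)

  walk-head : {P : A → Set} → ∀ {u v} → WalkIn R P u v → P u
  walk-head (here p)     = p
  walk-head (step p _ _) = p

  walk-reverse : (∀ {u v} → R u v → R v u) → {P : A → Set} →
                 ∀ {u v} → WalkIn R P u v → WalkIn R P v u
  walk-reverse s (here p)     = here p
  walk-reverse s (step p e w) =
    walk-reverse s w ⧺ step (walk-head w) (s e) (here p)

-- Subtrees of rooted trees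

least : ∀ {n} (P : Fin n → Set) → Decidable P → ∃ P →
        ∃[ z ] (P z × (∀ y → P y → toℕ z ≤ toℕ y))
least P P? (x , px)
  with Fin.¬∀⟶∃¬-smallest _ (¬_ ∘ P) (¬? ∘ P?) (λ none → none x px)
... | z , ¬¬pz , below =
  z , decidable-stable (P? z) ¬¬pz ,
  λ y py → ℕ.≮⇒≥ (λ y<z → below (fromℕ< y<z)
    (subst P (Fin.toℕ-injective (sym (trans (Fin.toℕ-inject (fromℕ< y<z)) (Fin.toℕ-fromℕ< y<z)))) py))

module _ (T : Tree) where

  private Node = Fin (suc (t T))

  data Desc (z : Node) : Node → Set where
    self  : Desc z z
    child : ∀ {i} → Desc z (parent T i) → Desc z (suc i)

  desc-≤ : ∀ {z y} → Desc z y → toℕ z ≤ toℕ y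
  desc-≤ self              = ℕ.≤-refl
  desc-≤ (child {i} d) = ℕ.≤-trans (desc-≤ d) (ℕ.m≤n⇒m≤1+n (parent≤ T i))

  -- The only edge leaving the descendants of `z` joins `z` to its parent, so a walk that gets out
  -- has to visit `z`.
  walk-exits-through-root : ∀ {P : Node → Set} {z y x} → WalkIn (TreeE T) P y x →
                            Desc z y → P z ⊎ Desc z x
  walk-exits-through-root (here _) d = inj₂ d
  walk-exits-through-root (step p (inj₁ (i , refl , refl)) w) self      = inj₁ p
  walk-exits-through-root (step p (inj₁ (i , refl , refl)) w) (child d) = walk-exits-through-root w d
  walk-exits-through-root (step p (inj₂ (i , refl , refl)) w) d         = walk-exits-through-root w (child d)

  -- Leaving the descendants of `z` would mean stepping from `z` to its parent, whose label is
  -- smaller.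
  walk-below-least : ∀ {P : Node → Set} {z y x} → (∀ y → P y → toℕ z ≤ toℕ y) →
                     WalkIn (TreeE T) P y x → Desc z y → Desc z x
  walk-below-least least-z (here _) d = d
  walk-below-least least-z (step p (inj₁ (i , refl , refl)) w) self =
    contradiction (ℕ.≤-trans (least-z _ (walk-head w)) (parent≤ T i)) (ℕ.<⇒≱ ℕ.≤-refl)
  walk-below-least least-z (step p (inj₁ (i , refl , refl)) w) (child d) = walk-below-least least-z w d
  walk-below-least least-z (step p (inj₂ (i , refl , refl)) w) d         = walk-below-least least-z w (child d)

  -- Labels increase away from node zero, so the node of least label in a subtree is its top node.
  IsRoot : (Node → Set) → Node → Set
  IsRoot P z = P z × (∀ y → P y → toℕ z ≤ toℕ y)

  Subtree : (Node → Set) → Set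
  Subtree P = ∀ x y → P x → P y → WalkIn (TreeE T) P x y

  -- The shared node lies below `z`. The walk in `P'` from it to `z'` either passes through `z` or
  -- ends at a descendant of `z`; in the second case the labels force `z'` to be `z`.
  later-root-shared : ∀ {P P' : Node → Set} {z z'} → Subtree P → Subtree P' →
                      IsRoot P z → IsRoot P' z' → toℕ z' ≤ toℕ z →
                      ∃[ y ] (P y × P' y) → P' z
  later-root-shared {P' = P'} {z} {z'} conn conn' (pz , least-z) (pz' , _) z'≤z (y , py , py')
    with walk-exits-through-root (conn' y z' py' pz')
           (walk-below-least least-z (conn z y pz py) self)
  ... | inj₁ p'z = p'z
  ... | inj₂ d   = subst P' (Fin.toℕ-injective (ℕ.≤-antisym z'≤z (desc-≤ d))) pz'

  -- Among pairwise intersecting subtrees, the root with the largest label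
  -- lies in all of them.
  helly : {I : Set} (F : I → Node → Set) → (∀ i → Decidable (F i)) →
          (∀ i → Subtree (F i)) → (∀ i j → ∃[ z ] (F i z × F j z)) →
          I → (is : List I) → ∃[ z ] (∀ {i} → i ∈ˡ is → F i z)
  helly {I} F F? conn meet i₀ is = proj₁ (top last) , λ {i} i∈ →
    later-root-shared (conn last) (conn i) (proj₂ (top last)) (proj₂ (top i))
      (All.lookup (f[xs]≤f[argmax] {f = label} i₀ is) i∈) (meet last i)
    where
    top : ∀ i → ∃ (IsRoot (F i))
    top i = least (F i) (F? i) (proj₁ (meet i i) , proj₁ (proj₂ (meet i i)))
    label : I → ℕ
    label i = toℕ (proj₁ (top i))
    last : I
    last = argmax label i₀ is

-- Lists

elements : ∀ {n} → Subset n → List (Fin n)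
elements []            = []
elements (inside ∷ p)  = zero ∷ map suc (elements p)
elements (outside ∷ p) = map suc (elements p)

length-elements : ∀ {n} (p : Subset n) → length (elements p) ≡ ∣ p ∣
length-elements []            = refl
length-elements (inside ∷ p)  = cong suc (trans (List.length-map suc (elements p)) (length-elements p))
length-elements (outside ∷ p) = trans (List.length-map suc (elements p)) (length-elements p)

∈-elements : ∀ {n} {x : Fin n} (p : Subset n) → x ∈ p → x ∈ˡ elements p
∈-elements (inside ∷ p)  here       = here refl
∈-elements (inside ∷ p)  (there x∈) = there (∈-map⁺ suc (∈-elements p x∈))
∈-elements (outside ∷ p) (there x∈) = ∈-map⁺ suc (∈-elements p x∈)

distinct-≤-length : ∀ {A : Set} {m} (f : Fin m → A) → (∀ {i j} → f i ≡ f j → i ≡ j) →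
                    (xs : List A) → (∀ i → f i ∈ˡ xs) → m ≤ length xs
distinct-≤-length f inj xs f∈ = Fin.injective⇒≤ {f = Any.index ∘ f∈} λ {i} {j} eq →
  inj (trans (Any.lookup-index (f∈ i))
        (trans (cong (lookup xs) eq) (sym (Any.lookup-index (f∈ j)))))

mapMaybe-Any : ∀ {A B : Set} {P : B → Set} (f : A → Maybe B) {x y} (xs : List A) →
               x ∈ˡ xs → f x ≡ just y → P y → Any P (mapMaybe f xs)
mapMaybe-Any {P = P} f xs x∈ eq py =
  Any.mapMaybe⁺ f xs (Any.map⁺ (Any.map (λ { refl → subst (MAny.Any P) (sym eq) (MAny.just py) }) x∈))

gather : ∀ {I : Set} {P : I → Set} → Decidable P → List I → List (Σ I P)
gather P? []       = []
gather P? (i ∷ is) with P? i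
... | yes p = (i , p) ∷ gather P? is
... | no  _ = gather P? is

-- The stored proof is the one returned by `P?`, which may differ from the given one; hence the
-- existential.
∈-gather : ∀ {I : Set} {P : I → Set} (P? : Decidable P) (is : List I) {i} → i ∈ˡ is → P i →
           ∃[ p ] ((i , p) ∈ˡ gather P? is)
∈-gather P? (i ∷ is) (here refl) p with P? i
... | yes p' = p' , here refl
... | no ¬p  = contradiction p ¬p
∈-gather P? (j ∷ is) (there i∈) p with P? j | ∈-gather P? is i∈ p
... | yes _ | p' , i∈' = p' , there i∈'
... | no _  | r        = r

-- Minor models of grids in S · H

Point : Set
Point = ℕ × ℕ

position : ∀ {k} → Fin k × Fin k → Point
position (i , j) = toℕ i , toℕ j

GridConnected : ℕ → (Point → Set) → Set
GridConnected k Q = ∀ g g' → Q (position g) → Q (position g') →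
                    WalkIn (GridE {k}) (Q ∘ position) g g'

Touching : ℕ → (Point → Set) → (Point → Set) → Set
Touching k Q Q' = ∃[ g ] ∃[ g' ] (Q (position g) × Q' (position g') × (g ≡ g' ⊎ GridE {k} g g'))

module Model {m n k : ℕ} (H : FinGraph n) (M : Grid k ≼ (Star m · ⟦ H ⟧)) where

  open MinorModel M

  G = Star m · ⟦ H ⟧

  β° : Fin (suc m) × Fin n → Maybe Point
  β° x = Maybe.map position (β x)

  -- The grid points whose branch sets meet copy `s` in a vertex of `vs`. A point may be repeated,
  -- once per vertex, so lengths are bounded by numbers of vertices.
  points : Fin (suc m) → List (Fin n) → List Point
  points s = mapMaybe (λ v → β° (s , v))

  rootPoints : List Point
  rootPoints = points zero (allFin n)

  length-points : ∀ s → length (points s (allFin n)) ≤ n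
  length-points s = ℕ.≤-trans (List.length-mapMaybe _ (allFin n)) (ℕ.≤-reflexive (List.length-tabulate id))

  Branch : (Point → Set) → Fin (suc m) × Fin n → Set
  Branch Q x = ∃[ g ] (β x ≡ just g × Q (position g))

  branch? : ∀ {Q} → Decidable Q → Decidable (Branch Q)
  branch? Q? x with β x
  ... | nothing = no λ { (_ , () , _) }
  ... | just g  = map′ (λ q → g , refl , q) (λ { (_ , refl , q) → q }) (Q? (position g))

  branch⇒Any : ∀ {Q s v vs} → v ∈ˡ vs → Branch Q (s , v) → Any Q (points s vs)
  branch⇒Any v∈ (g , eq , q) = mapMaybe-Any _ _ v∈ (cong (Maybe.map position) eq) q

  Free : (Point → Set) → Set
  Free Q = ¬ Any Q rootPoints

  free-off-root : ∀ {Q} → Free Q → ∀ {v} → ¬ Branch Q (zero , v)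
  free-off-root free b = free (branch⇒Any (∈-allFin _) b)

  lift-walk : ∀ {Q g g'} → WalkIn (GridE {k}) (Q ∘ position) g g' →
              ∀ x y → β x ≡ just g → β y ≡ just g' → WalkIn (E G) (Branch Q) x y
  lift-walk (here q) x y ex ey =
    walk-map (λ e → _ , e , q) (connected _ x y ex ey)
  lift-walk {Q} (step q e w) x y ex ey with adjacent _ _ e
  ... | x' , y' , ex' , ey' , e' =
    walk-map (λ e → _ , e , q) (connected _ x x' ex ex')
      ⧺ step (_ , ex' , q) e' (lift-walk {Q} w y' y ey' ey)

  -- Every edge of a star has the centre as an end, so outside the root copy only edges within a
  -- single copy of `H` remain.
  leaf-edge : ∀ {s s' u u'} → s ≢ zero → s' ≢ zero → E G (s , u) (s' , u') → s ≡ s' × Adj H u u'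
  leaf-edge s≢0 s'≢0 (inj₁ (inj₁ (s≡0 , _))) = contradiction s≡0 s≢0
  leaf-edge s≢0 s'≢0 (inj₁ (inj₂ (s'≡0 , _))) = contradiction s'≡0 s'≢0
  leaf-edge s≢0 s'≢0 (inj₂ e) = e

  free-edge : ∀ {Q Q' s s' u u'} → Free Q → Free Q' → Branch Q (s , u) → Branch Q' (s' , u') →
              E G (s , u) (s' , u') → s ≡ s' × Adj H u u'
  free-edge free free' b b' = leaf-edge (λ { refl → free-off-root free b }) (λ { refl → free-off-root free' b' })

  walk-in-copy : ∀ {Q} → Free Q → ∀ {s s' u u'} → WalkIn (E G) (Branch Q) (s , u) (s' , u') →
                 s ≡ s' × WalkIn (Adj H) (λ v → Branch Q (s , v)) u u'
  walk-in-copy free (here b) = refl , here b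
  walk-in-copy free (step b e w) with free-edge free free b (walk-head w) e
  ... | refl , a with walk-in-copy free w
  ... | refl , w' = refl , step b a w'

  copy-connected : ∀ {Q} → Free Q → GridConnected k Q → ∀ {s s' u u'} →
                   Branch Q (s , u) → Branch Q (s' , u') →
                   s ≡ s' × WalkIn (Adj H) (λ v → Branch Q (s , v)) u u'
  copy-connected {Q} free conn (g , e , q) (g' , e' , q') =
    walk-in-copy free (lift-walk {Q} (conn g g' q q') _ _ e e')

  copy-touching : ∀ {Q Q'} → Free Q → Free Q' → Touching k Q Q' →
                  ∃[ s ] ∃[ u ] ∃[ u' ] (Branch Q (s , u) × Branch Q' (s , u') × (u ≡ u' ⊎ Adj H u u'))
  copy-touching free free' (g , .g , q , q' , inj₁ refl) with nonempty g
  ... | (s , u) , e = s , u , u , (g , e , q) , (g , e , q') , inj₁ refl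
  copy-touching free free' (g , g' , q , q' , inj₂ e) with adjacent g g' e
  ... | (s , u) , (s' , u') , eu , eu' , e' with free-edge free free' (g , eu , q) (g' , eu' , q') e'
  ... | refl , a = s , u , u' , (g , eu , q) , (g' , eu' , q') , inj₂ a

  -- Hitting brambles with root points and a bag

  module Decomposed (D : TreeDecomposition H) where

    Meets : (Fin n → Set) → Fin (suc (t (tree D))) → Set
    Meets L z = ∃[ v ] (v ∈ bag D z × L v)

    -- Consecutive vertices of the walk share a bag, and there the subtrees of nodes whose bags
    -- contain them are joined.
    meets-connected : ∀ {L u v x y} → WalkIn (Adj H) L u v → u ∈ bag D x → v ∈ bag D y →
                      WalkIn (TreeE (tree D)) (Meets L) x y
    meets-connected (here l) u∈ v∈ = walk-map (λ u∈ → _ , u∈ , l) (subtree D _ _ _ u∈ v∈)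
    meets-connected (step l a w) u∈ v∈ with covers-E D _ _ a
    ... | z , u∈z , u'∈z =
      walk-map (λ u∈ → _ , u∈ , l) (subtree D _ _ _ u∈ u∈z) ⧺ meets-connected w u'∈z v∈

    common-bag : ∀ {u u'} → u ≡ u' ⊎ Adj H u u' → ∃[ z ] (u ∈ bag D z × u' ∈ bag D z)
    common-bag {u} (inj₁ refl) with covers-V D u
    ... | z , u∈ = z , u∈ , u∈
    common-bag (inj₂ a) = covers-E D _ _ a

    -- Every member touches `i₀`, so all members live in the leaf copy `s` of `i₀`. Inside that copy
    -- each is connected, hence the nodes whose bags meet it form a subtree; touching members give
    -- intersecting subtrees, and the Helly property yields one bag meeting all of them.
    free-bramble-hit : {I : Set} (Q : I → Point → Set) → (∀ i → Decidable (Q i)) →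
      (∀ i → Free (Q i)) → (∀ i → GridConnected k (Q i)) → (∀ i j → Touching k (Q i) (Q j)) →
      I → (is : List I) →
      ∃[ s ] ∃[ z ] (∀ {i} → i ∈ˡ is → Any (Q i) (points s (elements (bag D z))))
    free-bramble-hit {I} Q Q? free conn touch i₀ is
      with copy-touching (free i₀) (free i₀) (touch i₀ i₀)
    ... | s , _ , _ , b₀ , _ = s , proj₁ centre ,
      λ i∈ → let v , v∈ , b = proj₂ centre i∈ in branch⇒Any (∈-elements (bag D (proj₁ centre)) v∈) b
      where
      F : I → Fin (suc (t (tree D))) → Set
      F i = Meets (λ v → Branch (Q i) (s , v))

      F? : ∀ i → Decidable (F i)
      F? i z = Fin.any? λ v → (v ∈? bag D z) ×-dec branch? {Q i} (Q? i) (s , v)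

      F-subtree : ∀ i → Subtree (tree D) (F i)
      F-subtree i x y (u , u∈ , b) (u' , u'∈ , b') =
        meets-connected (proj₂ (copy-connected {Q i} (free i) (conn i) b b')) u∈ u'∈

      -- Members `i` and `j` touch in some copy `s'`; connectedness of `i` and its contact with `i₀`
      -- identify `s'` with `s`.
      F-meet : ∀ i j → ∃[ z ] (F i z × F j z)
      F-meet i j
        with copy-touching (free i) (free j) (touch i j) | copy-touching (free i) (free i₀) (touch i i₀)
      ... | s' , u , u' , b , b' , a | s'' , _ , _ , c , c₀ , _
        with copy-connected (free i) (conn i) b c | copy-connected (free i₀) (conn i₀) c₀ b₀
      ... | refl , _ | refl , _ with common-bag a
      ... | z , u∈ , u'∈ = z , (u , u∈ , b) , (u' , u'∈ , b')

      centre = helly (tree D) F F? F-subtree F-meet i₀ is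

    -- Members that are not free are hit by root points by definition, so only the free ones have to
    -- be hit by a bag.
    bramble-hit : ∀ {w} → WidthAtMost D w →
      {I : Set} (Q : I → Point → Set) → (∀ i → Decidable (Q i)) →
      (∀ i → GridConnected k (Q i)) → (∀ i j → Touching k (Q i) (Q j)) → (is : List I) →
      ∃[ L ] (length L ≤ suc w × (∀ {i} → i ∈ˡ is → Any (Q i) rootPoints ⊎ Any (Q i) L))
    bramble-hit {w} width {I} Q Q? conn touch is = from (gather free? is) (∈-gather free? is)
      where
      free? : Decidable (Free ∘ Q)
      free? i = ¬? (Any.any? (Q? i) rootPoints)

      Hit : List Point → I → Set
      Hit L i = Any (Q i) rootPoints ⊎ Any (Q i) L

      decide : ∀ {L i} → (Free (Q i) → Any (Q i) L) → Hit L i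
      decide {i = i} f with Any.any? (Q? i) rootPoints
      ... | yes h   = inj₁ h
      ... | no free = inj₂ (f free)

      from : (js : List (Σ I (Free ∘ Q))) →
             (∀ {i} → i ∈ˡ is → Free (Q i) → ∃[ p ] ((i , p) ∈ˡ js)) →
             ∃[ L ] (length L ≤ suc w × (∀ {i} → i ∈ˡ is → Hit L i))
      -- Without a free member no leaf copy is singled out, and the empty list suffices.
      from [] ∈js = [] , z≤n , λ i∈ → decide λ free → case ∈js i∈ free of λ ()
      from js@(j₀ ∷ _) ∈js =
        let s , z , hit = free-bramble-hit (Q ∘ proj₁) (Q? ∘ proj₁) proj₂ (conn ∘ proj₁)
                            (λ i j → touch (proj₁ i) (proj₁ j)) j₀ js
            bagList = elements (bag D z)
        in points s bagList ,
           ℕ.≤-trans (List.length-mapMaybe _ bagList)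
             (ℕ.≤-trans (ℕ.≤-reflexive (length-elements (bag D z))) (width z)) ,
           λ i∈ → decide λ free → hit (proj₂ (∈js i∈ free))

-- Brambles in grids

HSeg VSeg : ℕ → ℕ → ℕ → Point → Set
HSeg r lo hi (x , y) = x ≡ r × lo ≤ y × y < hi
VSeg c lo hi (x , y) = y ≡ c × lo ≤ x × x < hi

hseg? : ∀ r lo hi → Decidable (HSeg r lo hi)
hseg? r lo hi (x , y) = x ℕ.≟ r ×-dec lo ℕ.≤? y ×-dec y ℕ.<? hi

vseg? : ∀ c lo hi → Decidable (VSeg c lo hi)
vseg? c lo hi (x , y) = y ℕ.≟ c ×-dec lo ℕ.≤? x ×-dec x ℕ.<? hi

module _ {k : ℕ} where

  path-up : ∀ {lo hi} d (x y : Fin k) → toℕ x + d ≡ toℕ y → lo ≤ toℕ x → toℕ y < hi →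
            WalkIn Adj1 (λ z → lo ≤ toℕ z × toℕ z < hi) x y
  path-up zero x y eq lo≤ <hi
    with Fin.toℕ-injective {i = x} {y} (trans (sym (ℕ.+-identityʳ _)) eq)
  ... | refl = here (lo≤ , <hi)
  path-up {hi = hi} (suc d) x y eq lo≤ <hi =
    step (lo≤ , ℕ.<-trans x<y <hi) (inj₁ (sym x'≡))
      (path-up d x' y (trans (cong (_+ d) x'≡) eq') (ℕ.≤-trans (ℕ.m≤n⇒m≤1+n lo≤) (ℕ.≤-reflexive (sym x'≡))) <hi)
    where
    eq' : suc (toℕ x) + d ≡ toℕ y
    eq' = trans (sym (ℕ.+-suc (toℕ x) d)) eq
    x<y : suc (toℕ x) ≤ toℕ y
    x<y = ℕ.≤-trans (ℕ.m≤m+n _ d) (ℕ.≤-reflexive eq')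
    x' = fromℕ< (ℕ.≤-<-trans x<y (Fin.toℕ<n y))
    x'≡ : toℕ x' ≡ suc (toℕ x)
    x'≡ = Fin.toℕ-fromℕ< _

  path : ∀ {lo hi} (x y : Fin k) → lo ≤ toℕ x × toℕ x < hi → lo ≤ toℕ y × toℕ y < hi →
         WalkIn Adj1 (λ z → lo ≤ toℕ z × toℕ z < hi) x y
  path x y (lo≤x , x<hi) (lo≤y , y<hi) with ℕ.≤-total (toℕ x) (toℕ y)
  ... | inj₁ x≤y = path-up _ x y (ℕ.m+[n∸m]≡n x≤y) lo≤x y<hi
  ... | inj₂ y≤x = walk-reverse swap (path-up _ y x (ℕ.m+[n∸m]≡n y≤x) lo≤y x<hi)

  hseg-connected : ∀ {r lo hi} → GridConnected k (HSeg r lo hi)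
  hseg-connected (i , j) (i' , j') (refl , q) (eq , q') with Fin.toℕ-injective eq
  ... | refl = walk-image (i ,_) (λ a → inj₁ (refl , a)) (refl ,_) (path j j' q q')

  vseg-connected : ∀ {c lo hi} → GridConnected k (VSeg c lo hi)
  vseg-connected (i , j) (i' , j') (refl , q) (eq , q') with Fin.toℕ-injective eq
  ... | refl = walk-image (_, j) (λ a → inj₂ (refl , a)) (refl ,_) (path i i' q q')

  grid-point : ∀ {x y} → x < k → y < k → ∃[ g ] (position {k} g ≡ (x , y))
  grid-point x<k y<k = (fromℕ< x<k , fromℕ< y<k) , cong₂ _,_ (Fin.toℕ-fromℕ< x<k) (Fin.toℕ-fromℕ< y<k)

  ∪-connected : ∀ {Q Q'} → GridConnected k Q → GridConnected k Q' →
                ∀ {x y} → x < k → y < k → Q (x , y) → Q' (x , y) → GridConnected k (Q ∪ Q')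
  ∪-connected {Q} {Q'} conn conn' x<k y<k q q' with grid-point x<k y<k
  ... | c , refl = λ g g' s s' → to-centre g s ⧺ walk-reverse (E-sym (Grid k)) (to-centre g' s')
    where
    to-centre : ∀ g → (Q ∪ Q') (position g) → WalkIn GridE ((Q ∪ Q') ∘ position) g c
    to-centre g (inj₁ s) = walk-map inj₁ (conn g c s q)
    to-centre g (inj₂ s) = walk-map inj₂ (conn' g c s q')

  touching-at : ∀ {Q Q' : Point → Set} {x y} → x < k → y < k → Q (x , y) → Q' (x , y) → Touching k Q Q'
  touching-at x<k y<k q q' with grid-point x<k y<k
  ... | g , refl = g , g , q , q' , inj₁ refl

  touching-below : ∀ {Q Q' : Point → Set} {x x' y} → suc x ≡ x' → x' < k → y < k →
                   Q (x , y) → Q' (x' , y) → Touching k Q Q'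
  touching-below {Q} {Q'} refl x'<k y<k q q' =
    let x<k = ℕ.<-trans ℕ.≤-refl x'<k
        x≡  = Fin.toℕ-fromℕ< x<k
        x'≡ = Fin.toℕ-fromℕ< x'<k
        y≡  = Fin.toℕ-fromℕ< y<k
    in (fromℕ< x<k , fromℕ< y<k) , (fromℕ< x'<k , fromℕ< y<k) ,
       subst Q (sym (cong₂ _,_ x≡ y≡)) q , subst Q' (sym (cong₂ _,_ x'≡ y≡)) q' ,
       inj₂ (inj₂ (refl , inj₁ (trans (cong suc x≡) (sym x'≡))))

  touching-right : ∀ {Q Q' : Point → Set} {x y y'} → suc y ≡ y' → x < k → y' < k →
                   Q (x , y) → Q' (x , y') → Touching k Q Q'
  touching-right {Q} {Q'} refl x<k y'<k q q' =
    let y<k = ℕ.<-trans ℕ.≤-refl y'<k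
        x≡  = Fin.toℕ-fromℕ< x<k
        y'≡ = Fin.toℕ-fromℕ< y'<k
        y≡  = Fin.toℕ-fromℕ< y<k
    in (fromℕ< x<k , fromℕ< y<k) , (fromℕ< x<k , fromℕ< y'<k) ,
       subst Q (sym (cong₂ _,_ x≡ y≡)) q , subst Q' (sym (cong₂ _,_ x≡ y'≡)) q' ,
       inj₂ (inj₁ (refl , inj₁ (trans (cong suc y≡) (sym y'≡))))

  touching-sym : ∀ {Q Q' : Point → Set} → Touching k Q Q' → Touching k Q' Q
  touching-sym (g , g' , q , q' , inj₁ eq) = g' , g , q' , q , inj₁ (sym eq)
  touching-sym (g , g' , q , q' , inj₂ e)  = g' , g , q' , q , inj₂ (E-sym (Grid k) e)

-- Crosses alone give order `p` in a square of side `p`. The two extra lines, disjoint from the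
-- crosses and from each other, add two to the order for one more unit of side; this is the saving
-- that turns `p ≤ tw + 1 + x` into `p ≤ tw + x`.
data Line (p : ℕ) : Set where
  cross        : Fin p → Fin p → Line p
  bottom right : Line p

lines : ∀ p → List (Line p)
lines p = bottom ∷ right ∷ cartesianProductWith cross (allFin p) (allFin p)

∈-lines : ∀ {p} (l : Line p) → l ∈ˡ lines p
∈-lines (cross i j) = there (there (∈-cartesianProductWith⁺ cross (∈-allFin i) (∈-allFin j)))
∈-lines bottom      = here refl
∈-lines right       = there (here refl)

offset-injective : ∀ {p} a {i j : Fin p} → a + toℕ i ≡ a + toℕ j → i ≡ j
offset-injective a = Fin.toℕ-injective ∘ ℕ.+-cancelˡ-≡ a _ _

within : ∀ a {p} (i : Fin p) → a ≤ a + toℕ i × a + toℕ i < a + p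
within a i = ℕ.m≤m+n a (toℕ i) , ℕ.+-monoʳ-< a (Fin.toℕ<n i)

all-labels-≤ : ∀ {A : Set} (f : A → ℕ) a m (L : List A) →
               (∀ (i : Fin m) → Any (λ x → f x ≡ a + toℕ i) L) → m ≤ length L
all-labels-≤ f a m L hit = ℕ.≤-trans
  (distinct-≤-length (λ i → a + toℕ i) (offset-injective a) (map f L)
    (λ i → Any.map⁺ (Any.map sym (hit i))))
  (ℕ.≤-reflexive (List.length-map f L))

-- The bramble of order p + 2 in the square of side p + 1 with corner (a , b).
module Bramble (a b p : ℕ) where

  line : Line p → Point → Set
  line (cross i j) = HSeg (a + toℕ i) b (b + p) ∪ VSeg (b + toℕ j) a (a + p)
  -- The bottom row owns the corner and the right column stops just above it: the two are disjoint
  -- but adjacent.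
  line bottom      = HSeg (a + p) b (suc (b + p))
  line right       = VSeg (b + p) a (a + p)

  line? : ∀ l → Decidable (line l)
  line? (cross i j) g = hseg? (a + toℕ i) b (b + p) g ⊎-dec vseg? (b + toℕ j) a (a + p) g
  line? bottom        = hseg? (a + p) b (suc (b + p))
  line? right         = vseg? (b + p) a (a + p)

  module _ {k : ℕ} (a≤ : a + p < k) (b≤ : b + p < k) where

    row<k : ∀ (i : Fin p) → a + toℕ i < k
    row<k i = ℕ.<-trans (proj₂ (within a i)) a≤

    col<k : ∀ (j : Fin p) → b + toℕ j < k
    col<k j = ℕ.<-trans (proj₂ (within b j)) b≤

    line-connected : ∀ l → GridConnected k (line l)
    line-connected (cross i j) = ∪-connected
      {Q = HSeg (a + toℕ i) b (b + p)} {VSeg (b + toℕ j) a (a + p)} hseg-connected vseg-connected (row<k i) (col<k j)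
      (refl , within b j) (refl , within a i)
    line-connected bottom = hseg-connected
    line-connected right  = vseg-connected

  module _ {k p' : ℕ} (p≡ : p ≡ suc p') (a≤ : a + p < k) (b≤ : b + p < k) where

    private
      next : ∀ c → suc (c + p') ≡ c + p
      next c = trans (sym (ℕ.+-suc c p')) (cong (c +_) (sym p≡))

      in-last : ∀ c → c ≤ c + p' × c + p' < c + p
      in-last c = ℕ.m≤m+n c p' , ℕ.≤-reflexive (next c)

      cross-bottom : ∀ {i j} → Touching k (line (cross i j)) (line bottom)
      cross-bottom {i} {j} = touching-below {Q = line (cross i j)} {line bottom} (next a) a≤ (col<k a≤ b≤ j)
        (inj₂ (refl , in-last a))
        (refl , proj₁ (within b j) , ℕ.m≤n⇒m≤1+n (proj₂ (within b j)))

      cross-right : ∀ {i j} → Touching k (line (cross i j)) (line right)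
      cross-right {i} {j} = touching-right {Q = line (cross i j)} {line right} (next b) (row<k a≤ b≤ i) b≤
        (inj₁ (refl , in-last b)) (refl , within a i)

      right-bottom : Touching k (line right) (line bottom)
      right-bottom = touching-below {Q = line right} {line bottom} (next a) a≤ b≤
        (refl , in-last a) (refl , ℕ.m≤m+n b p , ℕ.≤-refl)

    -- The row of one cross meets the column of another. The bottom and the right column touch other
    -- lines through edges leaving row `a + p'` or column `b + p'`, which is why `p` has to be
    -- positive.
    line-touching : ∀ l l' → Touching k (line l) (line l')
    line-touching (cross i j) (cross i' j') = touching-at {Q = line (cross i j)} {line (cross i' j')}
      (row<k a≤ b≤ i) (col<k a≤ b≤ j')
      (inj₁ (refl , within b j')) (inj₂ (refl , within a i))
    line-touching (cross i j) bottom = cross-bottom {i} {j}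
    line-touching (cross i j) right  = cross-right {i} {j}
    line-touching bottom (cross i j) = touching-sym {Q = line (cross i j)} {line bottom} (cross-bottom {i} {j})
    line-touching bottom bottom      = touching-at {Q = line bottom} {line bottom} a≤ b≤
      (refl , ℕ.m≤m+n b p , ℕ.≤-refl) (refl , ℕ.m≤m+n b p , ℕ.≤-refl)
    line-touching bottom right       = touching-sym {Q = line right} {line bottom} right-bottom
    line-touching right (cross i j)  = touching-sym {Q = line (cross i j)} {line right} (cross-right {i} {j})
    line-touching right bottom       = right-bottom
    line-touching right right        = touching-at {Q = line right} {line right} 
      (ℕ.<-trans (proj₂ (in-last a)) a≤) b≤
      (refl , in-last a) (refl , in-last a)

  -- Numbers the inner rows, the bottom and the right column consecutively from `a`, the right
  -- column last. These `p + 2` sets are disjoint, so a list showing all the labels has at least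
  -- `p + 2` entries. `colLabel` does the same for the inner columns, the right column and the
  -- bottom.
  rowLabel : Point → ℕ
  rowLabel (x , y) with y ℕ.≟ b + p ×-dec x ℕ.<? a + p
  ... | yes _ = suc (a + p)
  ... | no  _ = x

  colLabel : Point → ℕ
  colLabel (x , y) with x ℕ.≟ a + p
  ... | yes _ = suc (b + p)
  ... | no  _ = y

  rowLabel-right : ∀ {g} → line right g → rowLabel g ≡ suc (a + p)
  rowLabel-right {x , y} (y≡ , _ , x<) with y ℕ.≟ b + p ×-dec x ℕ.<? a + p
  ... | yes _ = refl
  ... | no ¬q = contradiction (y≡ , x<) ¬q

  rowLabel-bottom : ∀ {g} → line bottom g → rowLabel g ≡ a + p
  rowLabel-bottom {x , y} (x≡ , _) with y ℕ.≟ b + p ×-dec x ℕ.<? a + p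
  ... | yes (_ , x<) = contradiction x< (ℕ.<-irrefl x≡)
  ... | no _ = x≡

  rowLabel-row : ∀ {r g} → HSeg r b (b + p) g → rowLabel g ≡ r
  rowLabel-row {r} {x , y} (x≡ , _ , y<) with y ℕ.≟ b + p ×-dec x ℕ.<? a + p
  ... | yes (y≡ , _) = contradiction y< (ℕ.<-irrefl y≡)
  ... | no _ = x≡

  colLabel-bottom : ∀ {g} → line bottom g → colLabel g ≡ suc (b + p)
  colLabel-bottom {x , y} (x≡ , _) with x ℕ.≟ a + p
  ... | yes _ = refl
  ... | no x≢ = contradiction x≡ x≢

  colLabel-column : ∀ {c g} → VSeg c a (a + p) g → colLabel g ≡ c
  colLabel-column {c} {x , y} (y≡ , _ , x<) with x ℕ.≟ a + p
  ... | yes x≡ = contradiction x< (ℕ.<-irrefl x≡)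
  ... | no _   = y≡

  labels-≤ : (f : Point → ℕ) (c : ℕ) (L : List Point) →
             (∀ (i : Fin p) → Any (λ x → f x ≡ c + toℕ i) L) →
             Any (λ x → f x ≡ c + p) L → Any (λ x → f x ≡ suc (c + p)) L → suc (suc p) ≤ length L
  labels-≤ f c L inner last extra = all-labels-≤ f c (suc (suc p)) L hit
    where
    hit : ∀ (i : Fin (suc (suc p))) → Any (λ x → f x ≡ c + toℕ i) L
    hit i with toℕ i ℕ.<? p | toℕ i ℕ.≟ p
    ... | yes i<p | _ = subst (λ t → Any (λ x → f x ≡ c + t) L) (Fin.toℕ-fromℕ< i<p) (inner (fromℕ< i<p))
    ... | no _ | yes i≡p = subst (λ t → Any (λ x → f x ≡ c + t) L) (sym i≡p) last
    ... | no i≮p | no i≢p = subst (λ t → Any (λ x → f x ≡ t) L)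
      (trans (sym (ℕ.+-suc c p))
        (cong (c +_) (ℕ.≤-antisym (ℕ.≤∧≢⇒< (ℕ.≮⇒≥ i≮p) (i≢p ∘ sym)) (ℕ.≤-pred (Fin.toℕ<n i))))) extra

  -- A hitting set either meets every row, hence all rows, the bottom and the
  -- right column, which are disjoint, or misses a row and then meets every column.
  bramble-order : (L : List Point) → (∀ l → Any (line l) L) → suc (suc p) ≤ length L
  bramble-order L hit with Fin.all? (λ i → Any.any? (hseg? (a + toℕ i) b (b + p)) L)
  ... | yes rows = labels-≤ rowLabel a L (λ i → Any.map rowLabel-row (rows i))
    (Any.map rowLabel-bottom (hit bottom)) (Any.map rowLabel-right (hit right))
  ... | no ¬rows with Fin.¬∀⟶∃¬ p _ (λ i → Any.any? (hseg? (a + toℕ i) b (b + p)) L) ¬rows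
  ... | i , ¬row = labels-≤ colLabel b L column
    (Any.map colLabel-column (hit right)) (Any.map colLabel-bottom (hit bottom))
    where
    column : ∀ j → Any (λ x → colLabel x ≡ b + toℕ j) L
    column j with find (hit (cross i j))
    ... | g , g∈ , inj₁ h = contradiction (lose g∈ h) ¬row
    ... | g , g∈ , inj₂ v = lose g∈ (colLabel-column v)

-- Cells

length-cartesianProductWith : ∀ {A B C : Set} (f : A → B → C) xs ys →
                              length (cartesianProductWith f xs ys) ≡ length xs * length ys
length-cartesianProductWith f []       ys = refl
length-cartesianProductWith f (x ∷ xs) ys = trans (List.length-++ (map (f x) ys))
  (cong₂ _+_ (List.length-map (f x) ys) (length-cartesianProductWith f xs ys))

Any-filter : ∀ {A : Set} {P Q : A → Set} (P? : Decidable P) → Q ⊆ P →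
             ∀ {xs} → Any Q xs → Any Q (filter P? xs)
Any-filter P? Q⊆P h with find h
... | x , x∈ , q = lose (∈-filter⁺ P? x∈ (Q⊆P q)) q

Rect : ℕ → ℕ → ℕ → ℕ → Point → Set
Rect a a' b b' (x , y) = (a ≤ x × x < a') × (b ≤ y × y < b')

rect? : ∀ a a' b b' → Decidable (Rect a a' b b')
rect? a a' b b' (x , y) = (a ℕ.≤? x ×-dec x ℕ.<? a') ×-dec (b ℕ.≤? y ×-dec y ℕ.<? b')

module Cells {m n k : ℕ} (H : FinGraph n) (M : Grid k ≼ (Star m · ⟦ H ⟧)) where

  open MinorModel M
  open Model H M

  rootsIn : ℕ → ℕ → ℕ → ℕ → List Point
  rootsIn a a' b b' = filter (rect? a a' b b') rootPoints

  count : ℕ → ℕ → ℕ → ℕ → ℕ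
  count a a' b b' = length (rootsIn a a' b b')

  count≤n : ∀ a a' b b' → count a a' b b' ≤ n
  count≤n a a' b b' = ℕ.≤-trans (List.length-filter (rect? a a' b b') rootPoints) (length-points zero)

  module _ (D : TreeDecomposition H) {w : ℕ} (width : WidthAtMost D w) where

    -- The root points of the cell and one bag together hit a bramble of order `p + 1`, so `p + 1`
    -- is at most their number plus `w + 1`. Side at least 2 leaves an inner square for the crosses.
    treewidth-cell : ∀ a b p → 2 ≤ p → a + p ≤ k → b + p ≤ k → p ≤ w + count a (a + p) b (b + p)
    treewidth-cell a b 1 (s≤s ())
    treewidth-cell a b (suc (suc p')) _ a≤ b≤ = ℕ.≤-pred (begin
      suc (suc p)                              ≤⟨ bramble-order (cellRoots ++ L) hit ⟩
      length (cellRoots ++ L)                  ≡⟨ List.length-++ cellRoots ⟩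
      length cellRoots + length L              ≤⟨ ℕ.+-monoʳ-≤ (length cellRoots) L≤ ⟩
      length cellRoots + suc w                 ≡⟨ ℕ.+-comm (length cellRoots) (suc w) ⟩
      suc (w + length cellRoots)               ∎)
      where
      open ℕ.≤-Reasoning
      -- From here `p` is the side of the inner square, one less than that of the cell.
      p = suc p'
      open Bramble a b p
      a< = ℕ.≤-trans (ℕ.≤-reflexive (sym (ℕ.+-suc a p))) a≤
      b< = ℕ.≤-trans (ℕ.≤-reflexive (sym (ℕ.+-suc b p))) b≤
      cellRoots = rootsIn a (a + suc p) b (b + suc p)
      bag-hit = Decomposed.bramble-hit D width line line?
        (line-connected a< b<) (line-touching refl a< b<) (lines p)
      L = proj₁ bag-hit
      L≤ = proj₁ (proj₂ bag-hit)

      grow : ∀ c {x} → c ≤ x × x < c + p → c ≤ x × x < c + suc p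
      grow c (c≤ , <c) = c≤ , ℕ.≤-trans (ℕ.m≤n⇒m≤1+n <c) (ℕ.≤-reflexive (sym (ℕ.+-suc c p)))

      last : ∀ c → c ≤ c + p × c + p < c + suc p
      last c = ℕ.m≤m+n c p , ℕ.≤-reflexive (sym (ℕ.+-suc c p))

      line-in-cell : ∀ l → line l ⊆ Rect a (a + suc p) b (b + suc p)
      line-in-cell (cross i j) (inj₁ (refl , y∈)) = grow a (within a i) , grow b y∈
      line-in-cell (cross i j) (inj₂ (refl , x∈)) = grow a x∈ , grow b (within b j)
      line-in-cell bottom (refl , b≤y , y<) = last a , b≤y , ℕ.≤-trans y< (ℕ.≤-reflexive (sym (ℕ.+-suc b p)))
      line-in-cell right (refl , x∈) = grow a x∈ , last b

      hit : ∀ l → Any (line l) (cellRoots ++ L)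
      hit l with proj₂ (proj₂ bag-hit) (∈-lines l)
      ... | inj₁ h = Any.++⁺ˡ (Any-filter (rect? a (a + suc p) b (b + suc p)) (line-in-cell l) h)
      ... | inj₂ h = Any.++⁺ʳ cellRoots h

  -- Unless the root copy meets all p columns, a column avoiding it joins the rows
  -- avoiding it, so that these lie in one leaf copy, which has n vertices.
  size-cell : ∀ a b p → a + p ≤ k → b + p ≤ k → p * p ≤ n + p * count a (a + p) b (b + p)
  size-cell a b p a≤ b≤ with Fin.all? (λ j → Any.any? (vseg? (b + toℕ j) a (a + p)) rootPoints)
  -- Disjoint columns need distinct root points, so the count is at least `p` and its term alone
  -- suffices.
  ... | yes columns-hit = ℕ.≤-trans
    (ℕ.*-monoʳ-≤ p (all-labels-≤ proj₂ b p (rootsIn a (a + p) b (b + p)) λ j →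
      Any.map proj₁ (Any-filter (rect? a (a + p) b (b + p)) (λ { (refl , x∈) → x∈ , within b j }) (columns-hit j))))
    (ℕ.m≤n+m _ n)
  ... | no ¬columns-hit with Fin.¬∀⟶∃¬ p _ (λ j → Any.any? (vseg? (b + toℕ j) a (a + p)) rootPoints) ¬columns-hit
  ... | j , column-free = conclusion (nonempty (proj₁ hub))
    where
    row< : ∀ (i : Fin p) → a + toℕ i < k
    row< i = ℕ.<-≤-trans (proj₂ (within a i)) a≤

    col< : ∀ (i : Fin p) → b + toℕ i < k
    col< i = ℕ.<-≤-trans (proj₂ (within b i)) b≤

    cellRoots = rootsIn a (a + p) b (b + p)

    cell : Fin p × Fin p → Point
    cell (i , c) = a + toℕ i , b + toℕ c

    cell-injective : ∀ {t t'} → cell t ≡ cell t' → t ≡ t'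
    cell-injective eq = cong₂ _,_ (offset-injective a (cong proj₁ eq)) (offset-injective b (cong proj₂ eq))

    -- Some point of the free column, to name the copy in which that column lives; `j` serves as row
    -- index only because it is an element of `Fin p`.
    hub = grid-point (row< j) (col< j)

    Column : Point → Set
    Column = VSeg (b + toℕ j) a (a + p)

    conclusion : ∃[ x ] (β x ≡ just (proj₁ hub)) → p * p ≤ n + p * length cellRoots
    conclusion ((s , u) , eu) = begin
      p * p                                      ≤⟨ distinct-≤-length (cell ∘ remQuot {p} p) (remQuot-injective ∘ cell-injective)
                                                      covered (∈covered ∘ remQuot {p} p) ⟩
      length covered                             ≡⟨ List.length-++ copyPoints ⟩
      length copyPoints + length rowsOfRoots     ≤⟨ ℕ.+-mono-≤ (length-points s) (ℕ.≤-reflexive rows-length) ⟩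
      n + p * length cellRoots                   ∎
      where
      open ℕ.≤-Reasoning
      copyPoints = points s (allFin n)
      -- A root point spoils at most the `p` points of its own row, whence the term `p * count`.
      -- Each remaining point lies in a free row and has a vertex of copy `s` in its branch set.
      rowsOfRoots = cartesianProductWith (λ g c → proj₁ g , b + toℕ c) cellRoots (allFin p)
      covered = copyPoints ++ rowsOfRoots

      rows-length : length rowsOfRoots ≡ p * length cellRoots
      rows-length = trans (length-cartesianProductWith _ cellRoots (allFin p))
        (trans (cong (length cellRoots *_) (List.length-tabulate id)) (ℕ.*-comm (length cellRoots) p))

      remQuot-injective : ∀ {t t' : Fin (p * p)} → remQuot {p} p t ≡ remQuot p t' → t ≡ t'
      remQuot-injective {t} {t'} eq = trans (sym (Fin.combine-remQuot {p} p t))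
        (trans (cong (λ (i , c) → combine i c) eq) (Fin.combine-remQuot {p} p t'))

      ∈covered : ∀ t → cell t ∈ˡ covered
      ∈covered (i , c) with Any.any? (hseg? (a + toℕ i) b (b + p)) rootPoints
      ... | yes h with find (Any-filter (rect? a (a + p) b (b + p)) (λ { (refl , y∈) → within a i , y∈ }) h)
      ...   | g , g∈ , refl , _ = ∈-++⁺ʳ copyPoints (∈-cartesianProductWith⁺ _ g∈ (∈-allFin c))
      ∈covered (i , c) | no row-free =
        let v , ev = nonempty (proj₁ target)
            same , _ = copy-connected {Cross} cross-free cross-connected
              (_ , eu , inj₂ (subst Column (sym (proj₂ hub)) (refl , within a j)))
              (_ , ev , inj₁ (subst Row (sym (proj₂ target)) (refl , within b c)))
        in ∈-++⁺ˡ (branch⇒Any {Q = cell (i , c) ≡_} (∈-allFin (proj₂ v))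
             (proj₁ target , trans (cong (λ s → β (s , proj₂ v)) same) ev , sym (proj₂ target)))
        where
        Row Cross : Point → Set
        Row = HSeg (a + toℕ i) b (b + p)
        Cross = Row ∪ Column
        target = grid-point (row< i) (col< c)
        cross-free : Free Cross
        cross-free h with find h
        ... | g , g∈ , inj₁ r = row-free (lose g∈ r)
        ... | g , g∈ , inj₂ r = column-free (lose g∈ r)
        cross-connected : GridConnected k Cross
        cross-connected = ∪-connected {Q = Row} {Column} hseg-connected vseg-connected (row< i) (col< j)
          (refl , within b j) (refl , within a i)

-- Sums over cells

module _ {A : Set} {P Q R : A → Set} (P? : Decidable P) (Q? : Decidable Q) (R? : Decidable R)
         (P⊆R : P ⊆ R) (Q⊆R : Q ⊆ R) (disjoint : ∀ {x} → P x → ¬ Q x) where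

  filter-superadditive : ∀ xs → length (filter P? xs) + length (filter Q? xs) ≤ length (filter R? xs)
  filter-superadditive [] = z≤n
  filter-superadditive (x ∷ xs) with P? x | Q? x | R? x | filter-superadditive xs
  ... | yes p | yes q | _     | _  = contradiction q (disjoint p)
  ... | yes _ | no _  | yes _ | ih = s≤s ih
  ... | no _  | yes _ | yes _ | ih = ℕ.≤-trans (ℕ.≤-reflexive (ℕ.+-suc _ _)) (s≤s ih)
  ... | no _  | no _  | yes _ | ih = ℕ.m≤n⇒m≤1+n ih
  ... | no _  | no _  | no _  | ih = ih
  ... | yes p | no _  | no ¬r | _  = contradiction (P⊆R p) ¬r
  ... | no _  | yes q | no ¬r | _  = contradiction (Q⊆R q) ¬r

-- `f x y` is thought of as a measure of the half-open interval from `x` to `y`, such as a number of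
-- root points. Superadditivity replaces explicit sums over cells.
SuperAdditive : (ℕ → ℕ → ℕ) → Set
SuperAdditive f = ∀ {x y z} → x ≤ y → y ≤ z → f x y + f y z ≤ f x z

strips : ∀ f → SuperAdditive f → ∀ {u α γ top} → (∀ x → x + u ≤ top → α ≤ γ + f x (x + u)) →
         ∀ m x → x + m * u ≤ top → m * α ≤ m * γ + f x (x + m * u)
strips f super each zero x _ = z≤n
strips f super {u} {α} {γ} {top} each (suc m) x x≤ = begin
  α + m * α                                        ≤⟨ ℕ.+-mono-≤ (each x (ℕ.≤-trans x+u≤ x≤))
                                                        (strips f super each m (x + u) (ℕ.≤-trans (ℕ.≤-reflexive assoc) x≤)) ⟩
  (γ + f x (x + u)) + (m * γ + f (x + u) y)        ≡⟨ shuffle γ (f x (x + u)) (m * γ) (f (x + u) y) ⟩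
  (γ + m * γ) + (f x (x + u) + f (x + u) y)        ≤⟨ ℕ.+-monoʳ-≤ (γ + m * γ) (super (ℕ.m≤m+n x u) (ℕ.m≤m+n (x + u) (m * u))) ⟩
  (γ + m * γ) + f x y                              ≡⟨ cong (λ t → γ + m * γ + f x t) assoc ⟩
  (γ + m * γ) + f x (x + (u + m * u))              ∎
  where
  open ℕ.≤-Reasoning
  y = x + u + m * u
  assoc : y ≡ x + (u + m * u)
  assoc = ℕ.+-assoc x u (m * u)
  x+u≤ : x + u ≤ x + (u + m * u)
  x+u≤ = ℕ.+-monoʳ-≤ x (ℕ.m≤m+n u (m * u))
  shuffle : ∀ a b c d → (a + b) + (c + d) ≡ (a + c) + (b + d)
  shuffle = solve-∀

-- Cutting into strips along one coordinate, and each strip along the other, adds up the bound of a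
-- single cell over `m * m'` cells.
blocks : (F : ℕ → ℕ → ℕ → ℕ → ℕ) →
         (∀ {b b'} → SuperAdditive (λ a a' → F a a' b b')) → (∀ {a a'} → SuperAdditive (F a a')) →
         ∀ {u α γ top} → (∀ a b → a + u ≤ top → b + u ≤ top → α ≤ γ + F a (a + u) b (b + u)) →
         ∀ m m' a b → a + m * u ≤ top → b + m' * u ≤ top →
         m * (m' * α) ≤ m * (m' * γ) + F a (a + m * u) b (b + m' * u)
blocks F rows cols each m m' a b a≤ b≤ =
  strips (λ x y → F x y b _) rows (λ x x≤ → strips (F x _) cols (λ y y≤ → each x y x≤ y≤) m' b b≤) m a a≤

module Totals {m n k : ℕ} (H : FinGraph n) (M : Grid k ≼ (Star m · ⟦ H ⟧)) where

  open Model H M using (rootPoints)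
  open Cells H M

  count-rows : ∀ {b b'} → SuperAdditive (λ a a' → count a a' b b')
  count-rows {b} {b'} {x} {y} {z} x≤y y≤z = filter-superadditive
    (rect? x y b b') (rect? y z b b') (rect? x z b b')
    (λ { ((x≤ , <y) , q) → (x≤ , ℕ.<-≤-trans <y y≤z) , q })
    (λ { ((y≤ , <z) , q) → (ℕ.≤-trans x≤y y≤ , <z) , q })
    (λ { ((_ , <y) , _) ((y≤ , _) , _) → ℕ.<⇒≱ <y y≤ }) rootPoints

  count-columns : ∀ {a a'} → SuperAdditive (count a a')
  count-columns {a} {a'} {x} {y} {z} x≤y y≤z = filter-superadditive
    (rect? a a' x y) (rect? a a' y z) (rect? a a' x z)
    (λ { (q , x≤ , <y) → q , x≤ , ℕ.<-≤-trans <y y≤z })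
    (λ { (q , y≤ , <z) → q , ℕ.≤-trans x≤y y≤ , <z })
    (λ { (_ , _ , <y) (_ , y≤ , _) → ℕ.<⇒≱ <y y≤ }) rootPoints

  count-mono-rows : ∀ {a a' a'' b b'} → a ≤ a' → a' ≤ a'' → count a a' b b' ≤ count a a'' b b'
  count-mono-rows a≤ a'≤ = ℕ.≤-trans (ℕ.m≤m+n _ _) (count-rows a≤ a'≤)

  count-mono-columns : ∀ {a a' b b' b''} → b ≤ b' → b' ≤ b'' → count a a' b b' ≤ count a a' b b''
  count-mono-columns b≤ b'≤ = ℕ.≤-trans (ℕ.m≤m+n _ _) (count-columns b≤ b'≤)

  size-bound : ∀ q p → q * p ≤ k → q * (q * (p * p)) ≤ q * (q * n) + p * n
  size-bound q p q*p≤k = ℕ.≤-trans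
    (blocks (λ a a' b b' → p * count a a' b b') (λ x≤y y≤z → scaled (count-rows x≤y y≤z))
      (λ x≤y y≤z → scaled (count-columns x≤y y≤z)) (λ a b → size-cell a b p) q q 0 0 q*p≤k q*p≤k)
    (ℕ.+-monoʳ-≤ (q * (q * n)) (ℕ.*-monoʳ-≤ p (count≤n 0 (q * p) 0 (q * p))))
    where
    scaled : ∀ {x y z} → x + y ≤ z → p * x + p * y ≤ p * z
    scaled {x} {y} x+y≤z = ℕ.≤-trans (ℕ.≤-reflexive (sym (ℕ.*-distribˡ-+ p x y))) (ℕ.*-monoʳ-≤ p x+y≤z)

  -- The side k is cut into r pieces of length p + 1 and s pieces of length p.
  treewidth-bound : (D : TreeDecomposition H) {w : ℕ} → WidthAtMost D w →
                    ∀ r s p → 2 ≤ p → r * suc p + s * p ≡ k →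
                    (r + s) * (r + s) * p + r * r ≤ n + (r + s) * (r + s) * w
  treewidth-bound D {w} width r s p 2≤p eq = begin
    (r + s) * (r + s) * p + r * r                                         ≡⟨ expand r s p ⟩
    (r * (r * suc p) + r * (s * p)) + s * ((r + s) * p)                   ≤⟨ ℕ.+-mono-≤ (ℕ.+-mono-≤ block₁ block₂) block₃ ⟩
    ((r * (r * w) + c₁) + (r * (s * w) + c₂)) + (s * ((r + s) * w) + c₃)  ≡⟨ collect r s w c₁ c₂ c₃ ⟩
    ((c₁ + c₂) + c₃) + (r + s) * (r + s) * w                              ≤⟨ ℕ.+-monoˡ-≤ _ total ⟩
    n + (r + s) * (r + s) * w                                             ∎
    where
    open ℕ.≤-Reasoning
    A = r * suc p
    A≤k : A ≤ k
    A≤k = ℕ.≤-trans (ℕ.m≤m+n A (s * p)) (ℕ.≤-reflexive eq)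
    rp≤A : r * p ≤ A
    rp≤A = ℕ.*-monoʳ-≤ r (ℕ.n≤1+n p)
    qp≤k : (r + s) * p ≤ k
    qp≤k = ℕ.≤-trans (ℕ.≤-reflexive (ℕ.*-distribʳ-+ p r s)) (ℕ.≤-trans (ℕ.+-monoˡ-≤ (s * p) rp≤A) (ℕ.≤-reflexive eq))
    -- Three disjoint regions: the `r * r` enlarged cells in the corner, `r * s` cells of side `p`
    -- beside them, and `s * (r + s)` such cells below. Each enlarged cell gains one, which gives
    -- the term `r * r`.
    c₁ = count 0 A 0 A
    c₂ = count 0 (r * p) A (A + s * p)
    c₃ = count A (A + s * p) 0 ((r + s) * p)
    cells : ∀ p → 2 ≤ p → ∀ m m' a b → a + m * p ≤ k → b + m' * p ≤ k →
            m * (m' * p) ≤ m * (m' * w) + count a (a + m * p) b (b + m' * p)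
    cells p 2≤p = blocks count count-rows count-columns (λ a b → treewidth-cell D width a b p 2≤p)
    block₁ : r * (r * suc p) ≤ r * (r * w) + c₁
    block₁ = cells (suc p) (ℕ.m≤n⇒m≤1+n 2≤p) r r 0 0 A≤k A≤k
    block₂ : r * (s * p) ≤ r * (s * w) + c₂
    block₂ = cells p 2≤p r s 0 A (ℕ.≤-trans rp≤A A≤k) (ℕ.≤-reflexive eq)
    block₃ : s * ((r + s) * p) ≤ s * ((r + s) * w) + c₃
    block₃ = cells p 2≤p s (r + s) A 0 (ℕ.≤-reflexive eq) qp≤k
    upper : c₁ + c₂ ≤ count 0 A 0 k
    upper = ℕ.≤-trans (ℕ.+-monoʳ-≤ c₁ (count-mono-rows z≤n rp≤A))
      (ℕ.≤-trans (count-columns z≤n (ℕ.m≤m+n A (s * p))) (ℕ.≤-reflexive (cong (count 0 A 0) eq)))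
    lower : c₃ ≤ count A (A + s * p) 0 k
    lower = count-mono-columns z≤n qp≤k
    total : (c₁ + c₂) + c₃ ≤ n
    total = ℕ.≤-trans (ℕ.+-mono-≤ upper lower)
      (ℕ.≤-trans (count-rows z≤n (ℕ.m≤m+n A (s * p))) (count≤n 0 (A + s * p) 0 k))
    expand : ∀ r s p → (r + s) * (r + s) * p + r * r ≡ (r * (r * (1 + p)) + r * (s * p)) + s * ((r + s) * p)
    expand = solve-∀
    collect : ∀ r s w x y z → ((r * (r * w) + x) + (r * (s * w) + y)) + (s * ((r + s) * w) + z) ≡
                              ((x + y) + z) + (r + s) * (r + s) * w
    collect = solve-∀

  treewidth-bound-/ : (D : TreeDecomposition H) {w : ℕ} → WidthAtMost D w →
                      ∀ q .{{_ : NonZero q}} → 2 ≤ k / q →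
                      q * q * (k / q) + (k % q) * (k % q) ≤ n + q * q * w
  treewidth-bound-/ D {w} width q 2≤ = subst (λ t → t * t * (k / q) + r * r ≤ n + t * t * w) r+s≡q
    (treewidth-bound D width r s (k / q) 2≤ pieces)
    where
    r = k % q
    s = q ∸ r
    r+s≡q : r + s ≡ q
    r+s≡q = ℕ.m+[n∸m]≡n (ℕ.<⇒≤ (ℕ.m%n<n k q))
    regroup : ∀ r s p → r * (1 + p) + s * p ≡ r + p * (r + s)
    regroup = solve-∀
    pieces : r * suc (k / q) + s * (k / q) ≡ k
    pieces = trans (regroup r s (k / q)) (trans (cong (λ t → r + k / q * t) r+s≡q) (sym (ℕ.m≡m%n+[m/n]*n k q)))

-- Arithmetic

4ab≤a²+4b² : ∀ a b → 4 * (a * b) ≤ a * a + 4 * (b * b)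
4ab≤a²+4b² a b = ℕ.≤-trans (ℕ.≤-reflexive (double a b)) (ℕ.≤-trans (2xy≤x²+y² a (2 * b)) (ℕ.≤-reflexive (square a b)))
  where
  double : ∀ a b → 4 * (a * b) ≡ 2 * (a * (2 * b))
  double = solve-∀
  square : ∀ a b → a * a + (2 * b) * (2 * b) ≡ a * a + 4 * (b * b)
  square = solve-∀
  expand : ∀ x d → 2 * (x * (x + d)) + d * d ≡ x * x + (x + d) * (x + d)
  expand = solve-∀
  ordered : ∀ {x y} → x ≤ y → 2 * (x * y) ≤ x * x + y * y
  ordered {x} {y} x≤y = subst (λ y → 2 * (x * y) ≤ x * x + y * y) (ℕ.m+[n∸m]≡n x≤y)
    (ℕ.≤-trans (ℕ.m≤m+n _ _) (ℕ.≤-reflexive (expand x (y ∸ x))))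
  2xy≤x²+y² : ∀ x y → 2 * (x * y) ≤ x * x + y * y
  2xy≤x²+y² x y with ℕ.≤-total x y
  ... | inj₁ x≤y = ordered x≤y
  ... | inj₂ y≤x = subst₂ _≤_ (cong (2 *_) (ℕ.*-comm y x)) (ℕ.+-comm (y * y) (x * x)) (ordered y≤x)

-- With W = w + 1, this is the identity
-- 4 W n - k² = 4 W (n + q² w - q² p - r²) + W (q - 2 r)² + (3 W q² - (k - 2 W q)²).
near-critical : ∀ n w k q p r → k ≡ r + p * q → q * q * p + r * r ≤ n + q * q * w →
  k * k + 4 * suc w * suc w * (q * q) ≤ 4 * suc w * q * k + 3 * suc w * (q * q) →
  k * k ≤ 4 * (n * suc w)
near-critical n w .(r + p * q) q p r refl cells near = ℕ.+-cancelʳ-≤ slack _ _ (begin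
  k * k + slack                                                   ≡⟨ step₁ (k * k) q r w ⟩
  k * k + 4 * W * w * (q * q) + 3 * W * (q * q) + W * (4 * (q * r)) ≤⟨ ℕ.+-monoʳ-≤ (k * k + 4 * W * w * (q * q) + 3 * W * (q * q))
                                                                         (ℕ.*-monoʳ-≤ W (4ab≤a²+4b² q r)) ⟩
  k * k + 4 * W * w * (q * q) + 3 * W * (q * q) + W * (q * q + 4 * (r * r)) ≡⟨ step₂ (k * k) q r w ⟩
  k * k + 4 * W * W * (q * q) + 4 * W * (r * r)                   ≤⟨ ℕ.+-monoˡ-≤ (4 * W * (r * r)) near ⟩
  4 * W * q * k + 3 * W * (q * q) + 4 * W * (r * r)               ≡⟨ step₃ p q r w ⟩
  4 * W * (q * q * p + r * r) + (4 * W * (q * r) + 3 * W * (q * q)) ≤⟨ ℕ.+-monoˡ-≤ _ (ℕ.*-monoʳ-≤ (4 * W) cells) ⟩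
  4 * W * (n + q * q * w) + (4 * W * (q * r) + 3 * W * (q * q))   ≡⟨ step₄ n q r w ⟩
  4 * (n * W) + slack                                             ∎)
  where
  open ℕ.≤-Reasoning
  k = r + p * q
  W = suc w
  slack = 4 * W * w * (q * q) + 4 * W * (q * r) + 3 * W * (q * q)
  step₁ : ∀ x q r w → x + (4 * (1 + w) * w * (q * q) + 4 * (1 + w) * (q * r) + 3 * (1 + w) * (q * q)) ≡
                      x + 4 * (1 + w) * w * (q * q) + 3 * (1 + w) * (q * q) + (1 + w) * (4 * (q * r))
  step₁ = solve-∀
  step₂ : ∀ x q r w → x + 4 * (1 + w) * w * (q * q) + 3 * (1 + w) * (q * q) + (1 + w) * (q * q + 4 * (r * r)) ≡
                      x + 4 * (1 + w) * (1 + w) * (q * q) + 4 * (1 + w) * (r * r)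
  step₂ = solve-∀
  step₃ : ∀ p q r w → 4 * (1 + w) * q * (r + p * q) + 3 * (1 + w) * (q * q) + 4 * (1 + w) * (r * r) ≡
                      4 * (1 + w) * (q * q * p + r * r) + (4 * (1 + w) * (q * r) + 3 * (1 + w) * (q * q))
  step₃ = solve-∀
  step₄ : ∀ n q r w → 4 * (1 + w) * (n + q * q * w) + (4 * (1 + w) * (q * r) + 3 * (1 + w) * (q * q)) ≡
    4 * (n * (1 + w)) + (4 * (1 + w) * w * (q * q) + 4 * (1 + w) * (q * r) + 3 * (1 + w) * (q * q))
  step₄ = solve-∀

square-≤ : ∀ {a b} → a ≤ b → a * a ≤ b * b
square-≤ a≤b = ℕ.*-mono-≤ a≤b a≤b

-- For `s` up to about `10 W / 3` the factor `4` leaves room for `(W + 1)² / W²`. The 13 is what the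
-- strict inequalities `3 c² < 4 W` and `p + 3 < 2 W` yield for `s = c² + p`; after substituting
-- `W = 4 + v` the difference has positive coefficients only.
cubic : ∀ {W s} → 4 ≤ W → 3 * s + 13 ≤ 10 * W → suc W * suc W * s ≤ 4 * (W * W * W)
cubic {W} {s} 4≤W s≤ = ℕ.*-cancelˡ-≤ 3 (ℕ.+-cancelʳ-≤ (13 * (suc W * suc W)) _ _ (begin
  3 * (suc W * suc W * s) + 13 * (suc W * suc W)      ≡⟨ factor W s ⟩
  suc W * suc W * (3 * s + 13)                        ≤⟨ ℕ.*-monoʳ-≤ (suc W * suc W) s≤ ⟩
  suc W * suc W * (10 * W)                            ≤⟨ subst (λ W → suc W * suc W * (10 * W) ≤ 3 * (4 * (W * W * W)) + 13 * (suc W * suc W))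
                                                            (ℕ.m+[n∸m]≡n 4≤W) (shifted (W ∸ 4)) ⟩
  3 * (4 * (W * W * W)) + 13 * (suc W * suc W)        ∎))
  where
  open ℕ.≤-Reasoning
  factor : ∀ W s → 3 * ((1 + W) * (1 + W) * s) + 13 * ((1 + W) * (1 + W)) ≡ (1 + W) * (1 + W) * (3 * s + 13)
  factor = solve-∀
  difference : ∀ v → (5 + v) * (5 + v) * (10 * (4 + v)) + (93 + 56 * v + 17 * (v * v) + 2 * (v * v * v)) ≡
                     3 * (4 * ((4 + v) * (4 + v) * (4 + v))) + 13 * ((5 + v) * (5 + v))
  difference = solve-∀
  shifted : ∀ v → (5 + v) * (5 + v) * (10 * (4 + v)) ≤ 3 * (4 * ((4 + v) * (4 + v) * (4 + v))) + 13 * ((5 + v) * (5 + v))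
  shifted v = ℕ.≤-trans (ℕ.m≤m+n _ _) (ℕ.≤-reflexive (difference v))

-- A deficit `f` of at most `2 W` with `f² > 3 W c²` forces `3 c² < 4 W`, so there are few cells,
-- and `3 c < f` makes `p + 3 < 2 W`. Thus `c² + p` is below `10 W / 3` in the size bound. The
-- remaining factor covers `k ≤ c (p + 1)`, since `W ≤ p` gives `(p + 1) / p ≤ (W + 1) / W`.
far-from-critical : ∀ n W c p k f → 2 ≤ c → k + f ≡ 2 * W * c → f ≤ 2 * W → 3 * W * (c * c) < f * f →
  W ≤ p → c * p ≤ k → k ≤ c * suc p → c * (c * (p * p)) ≤ c * (c * n) + p * n → k * k ≤ 4 * (n * W)
far-from-critical n W c p k f 2≤c k+f≡ f≤2W f-large W≤p cp≤k k≤ size =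
  ℕ.*-cancelˡ-≤ (W * W * S) {{ℕ.m*n≢0 (W * W) S}} (begin
    W * W * S * (k * k)                               ≤⟨ ℕ.*-monoʳ-≤ (W * W * S) (square-≤ k≤) ⟩
    W * W * S * (c * suc p * (c * suc p))             ≡⟨ step₁ W S c p ⟩
    c * c * S * (W * suc p * (W * suc p))             ≤⟨ ℕ.*-monoʳ-≤ (c * c * S) (square-≤ W*[1+p]≤) ⟩
    c * c * S * (p * suc W * (p * suc W))             ≡⟨ step₂ W S c p ⟩
    c * (c * (p * p)) * (suc W * suc W * S)           ≤⟨ ℕ.*-mono-≤ size (cubic 4≤W S-small) ⟩
    (c * (c * n) + p * n) * (4 * (W * W * W))         ≡⟨ step₃ W n c p ⟩
    W * W * S * (4 * (n * W))                         ∎)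
  where
  open ℕ.≤-Reasoning
  S = c * c + p

  2W² : ∀ W → 2 * W * (2 * W) ≡ W * (4 * W)
  2W² = solve-∀
  3Wc² : ∀ W c → 3 * W * (c * c) ≡ W * (3 * (c * c))
  3Wc² = solve-∀
  3c²<4W : 3 * (c * c) < 4 * W
  3c²<4W = ℕ.*-cancelˡ-< W _ _ (begin-strict
    W * (3 * (c * c))   ≡⟨ 3Wc² W c ⟨
    3 * W * (c * c)     <⟨ f-large ⟩
    f * f               ≤⟨ square-≤ f≤2W ⟩
    2 * W * (2 * W)     ≡⟨ 2W² W ⟩
    W * (4 * W)         ∎)

  4≤W : 4 ≤ W
  4≤W = ℕ.*-cancelˡ-< 4 3 W (ℕ.≤-<-trans (ℕ.*-monoʳ-≤ 3 (square-≤ 2≤c)) 3c²<4W)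

  instance
    W≢0 : NonZero W
    W≢0 = >-nonZero (ℕ.≤-trans (s≤s z≤n) 4≤W)
    S≢0 : NonZero S
    S≢0 = >-nonZero (ℕ.≤-trans (s≤s z≤n) (ℕ.≤-trans 4≤W (ℕ.≤-trans W≤p (ℕ.m≤n+m p (c * c)))))
    W²≢0 : NonZero (W * W)
    W²≢0 = ℕ.m*n≢0 W W

  3c<f : 3 * c < f
  3c<f = ℕ.≰⇒> λ f≤3c → ℕ.<⇒≱ f-large (begin
    f * f               ≤⟨ square-≤ f≤3c ⟩
    3 * c * (3 * c)     ≡⟨ 9c² c ⟩
    3 * 3 * (c * c)     ≤⟨ ℕ.*-monoˡ-≤ (c * c) (ℕ.*-monoʳ-≤ 3 (ℕ.≤-trans (ℕ.n≤1+n 3) 4≤W)) ⟩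
    3 * W * (c * c)     ∎)
    where
    9c² : ∀ c → 3 * c * (3 * c) ≡ 3 * 3 * (c * c)
    9c² = solve-∀

  p+3<2W : p + 3 < 2 * W
  p+3<2W = ℕ.*-cancelʳ-< c _ _ (begin-strict
    (p + 3) * c     ≡⟨ distribute c p ⟩
    c * p + 3 * c   ≤⟨ ℕ.+-monoˡ-≤ (3 * c) cp≤k ⟩
    k + 3 * c       <⟨ ℕ.+-monoʳ-< k 3c<f ⟩
    k + f           ≡⟨ k+f≡ ⟩
    2 * W * c       ∎)
    where
    distribute : ∀ c p → (p + 3) * c ≡ c * p + 3 * c
    distribute = solve-∀

  S-small : 3 * S + 13 ≤ 10 * W
  S-small = begin
    3 * (c * c + p) + 13                  ≡⟨ split (c * c) p ⟩
    suc (3 * (c * c)) + 3 * suc (p + 3)   ≤⟨ ℕ.+-mono-≤ 3c²<4W (ℕ.*-monoʳ-≤ 3 p+3<2W) ⟩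
    4 * W + 3 * (2 * W)                   ≡⟨ ten W ⟩
    10 * W                                ∎
    where
    split : ∀ x p → 3 * (x + p) + 13 ≡ (1 + 3 * x) + 3 * (1 + (p + 3))
    split = solve-∀
    ten : ∀ W → 4 * W + 3 * (2 * W) ≡ 10 * W
    ten = solve-∀

  W*[1+p]≤ : W * suc p ≤ p * suc W
  W*[1+p]≤ = begin
    W * suc p     ≡⟨ ℕ.*-suc W p ⟩
    W + W * p     ≤⟨ ℕ.+-monoˡ-≤ (W * p) W≤p ⟩
    p + W * p     ≡⟨ cong (p +_) (ℕ.*-comm W p) ⟩
    p + p * W     ≡⟨ ℕ.*-suc p W ⟨
    p * suc W     ∎

  step₁ : ∀ W S c p → W * W * S * (c * (1 + p) * (c * (1 + p))) ≡ c * c * S * (W * (1 + p) * (W * (1 + p)))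
  step₁ = solve-∀
  step₂ : ∀ W S c p → c * c * S * (p * (1 + W) * (p * (1 + W))) ≡ c * (c * (p * p)) * ((1 + W) * (1 + W) * S)
  step₂ = solve-∀
  step₃ : ∀ W n c p → (c * (c * n) + p * n) * (4 * (W * W * W)) ≡ W * W * (c * c + p) * (4 * (n * W))
  step₃ = solve-∀

≤-quotient : ∀ x q k .{{_ : NonZero q}} → x * q ≤ k → x ≤ k / q
≤-quotient x q k xq≤k = ℕ.≤-trans (ℕ.≤-reflexive (sym (ℕ.m*n/n≡m x q))) (ℕ./-monoˡ-≤ q xq≤k)

-- Cells of side about 2 W, where W = w + 1, are optimal for the treewidth bound, so it is
-- tried with q = ⌊k / 2W⌋ and with q + 1; if k / q is too far from 2 W in both cases, then
-- 3 (q + 1)² < 4 W and the size bound suffices.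
grid-bound : ∀ n w k →
  (∀ q .{{_ : NonZero q}} → 2 ≤ k / q → q * q * (k / q) + (k % q) * (k % q) ≤ n + q * q * w) →
  (∀ q p → q * p ≤ k → q * (q * (p * p)) ≤ q * (q * n) + p * n) →
  k * k ≤ 4 * (n * suc w)
grid-bound n w k cells size = by-quotient (k / (2 * W)) (k % (2 * W)) (ℕ.m≡m%n+[m/n]*n k (2 * W)) (ℕ.m%n<n k (2 * W))
  where
  open ℕ.≤-Reasoning
  W = suc w

  near : ∀ q .{{_ : NonZero q}} → 2 ≤ k / q →
         k * k + 4 * W * W * (q * q) ≤ 4 * W * q * k + 3 * W * (q * q) → k * k ≤ 4 * (n * W)
  near q 2≤ = near-critical n w k q (k / q) (k % q) (ℕ.m≡m%n+[m/n]*n k q) (cells q 2≤)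

  by-quotient : ∀ q e → k ≡ e + q * (2 * W) → e < 2 * W → k * k ≤ 4 * (n * W)
  -- Here `k < 2 W`: the whole grid is taken as one cell, and `k² ≤ (k + 1) n` is more than enough.
  by-quotient zero e k≡ e<2W = begin
    k * k              ≡⟨ ones k ⟩
    1 * (1 * (k * k))  ≤⟨ size 1 k (ℕ.≤-reflexive (ℕ.*-identityˡ k)) ⟩
    1 * (1 * n) + k * n ≡⟨ collect n k ⟩
    suc k * n          ≤⟨ ℕ.*-monoˡ-≤ n (ℕ.≤-trans (ℕ.≤-reflexive (cong suc (trans k≡ (ℕ.+-identityʳ e)))) e<2W) ⟩
    2 * W * n          ≤⟨ ℕ.*-monoˡ-≤ n (ℕ.*-monoˡ-≤ W {2} {4} (s≤s (s≤s z≤n))) ⟩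
    4 * W * n          ≡⟨ reorder W n ⟩
    4 * (n * W)        ∎
    where
    ones : ∀ k → k * k ≡ 1 * (1 * (k * k))
    ones = solve-∀
    collect : ∀ n k → 1 * (1 * n) + k * n ≡ (1 + k) * n
    collect = solve-∀
    reorder : ∀ W n → 4 * W * n ≡ 4 * (n * W)
    reorder = solve-∀
  -- The excess `e = k - 2 W q`, and later the deficit `f = 2 W c - k` with `c = q + 1`, is the
  -- distance that `near-critical` compares, squared, with `3 W q²` or `3 W c²`.
  by-quotient q@(suc q₀) e k≡ e<2W with e * e ℕ.≤? 3 * W * (q * q)
  ... | yes e-small = near q (≤-quotient 2 q k 2q≤k)
    (ℕ.≤-trans (ℕ.≤-reflexive (excess W q e k k≡)) (ℕ.+-monoʳ-≤ (4 * W * q * k) e-small))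
    where
    2q≤k : 2 * q ≤ k
    2q≤k = begin
      2 * q              ≤⟨ ℕ.*-monoˡ-≤ q (ℕ.*-monoʳ-≤ 2 {1} {W} (s≤s z≤n)) ⟩
      2 * W * q          ≡⟨ ℕ.*-comm (2 * W) q ⟩
      q * (2 * W)        ≤⟨ ℕ.m≤n+m _ e ⟩
      e + q * (2 * W)    ≡⟨ k≡ ⟨
      k                  ∎
    expand : ∀ W q e → (e + q * (2 * W)) * (e + q * (2 * W)) + 4 * W * W * (q * q) ≡ 4 * W * q * (e + q * (2 * W)) + e * e
    expand = solve-∀
    excess : ∀ W q e k → k ≡ e + q * (2 * W) → k * k + 4 * W * W * (q * q) ≡ 4 * W * q * k + e * e
    excess W q e _ refl = expand W q e
  ... | no e-large = by-deficit (f * f ℕ.≤? 3 * W * (c * c))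
    where
    c = suc q
    f = 2 * W ∸ e
    e+f : e + f ≡ 2 * W
    e+f = ℕ.m+[n∸m]≡n (ℕ.<⇒≤ e<2W)

    k+f : k + f ≡ 2 * W * c
    k+f = begin-equality
      k + f                    ≡⟨ cong (_+ f) k≡ ⟩
      e + q * (2 * W) + f      ≡⟨ swap-last e (q * (2 * W)) f ⟩
      (e + f) + q * (2 * W)    ≡⟨ cong (_+ q * (2 * W)) e+f ⟩
      2 * W + q * (2 * W)      ≡⟨ ℕ.*-comm c (2 * W) ⟩
      2 * W * c                ∎
      where
      swap-last : ∀ x y z → x + y + z ≡ (x + z) + y
      swap-last = solve-∀

    W*c≤k : W * c ≤ k
    W*c≤k = begin
      W * c                  ≤⟨ ℕ.*-monoʳ-≤ W (s≤s (ℕ.m≤n+m q q₀)) ⟩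
      W * (q + q)            ≡⟨ double W q ⟩
      q * (2 * W)            ≤⟨ ℕ.m≤n+m _ e ⟩
      e + q * (2 * W)        ≡⟨ k≡ ⟨
      k                      ∎
      where
      double : ∀ W q → W * (q + q) ≡ q * (2 * W)
      double = solve-∀

    -- An excess of at most 1 would have been small enough above. This secures `2 c ≤ k` also for
    -- `W = 1`, where `W * c ≤ k` does not give it.
    2≤e : 2 ≤ e
    2≤e = ℕ.≰⇒> λ e≤1 → e-large (ℕ.≤-trans (square-≤ e≤1) (ℕ.*-mono-≤ {1} {3 * W} (s≤s z≤n) (s≤s z≤n)))

    2c≤k : 2 * c ≤ k
    2c≤k = begin
      2 * c                  ≡⟨ ℕ.*-suc 2 q ⟩
      2 + 2 * q              ≤⟨ ℕ.+-mono-≤ 2≤e (ℕ.≤-trans (ℕ.≤-reflexive (ℕ.*-comm 2 q))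
                                                  (ℕ.*-monoʳ-≤ q (ℕ.*-monoʳ-≤ 2 {1} {W} (s≤s z≤n)))) ⟩
      e + q * (2 * W)        ≡⟨ k≡ ⟨
      k                      ∎

    by-deficit : Dec (f * f ≤ 3 * W * (c * c)) → k * k ≤ 4 * (n * W)
    by-deficit (yes f-small) = near c (≤-quotient 2 c k 2c≤k)
      (ℕ.≤-trans (ℕ.≤-reflexive deficit) (ℕ.+-monoʳ-≤ (4 * W * c * k) f-small))
      where
      fourth : ∀ W c → 4 * W * W * (c * c) ≡ 2 * W * c * (2 * W * c)
      fourth = solve-∀
      expand : ∀ k f → k * k + (k + f) * (k + f) ≡ 2 * (k + f) * k + f * f
      expand = solve-∀
      twice : ∀ W c → 2 * (2 * W * c) ≡ 4 * W * c
      twice = solve-∀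
      deficit : k * k + 4 * W * W * (c * c) ≡ 4 * W * c * k + f * f
      deficit = begin-equality
        k * k + 4 * W * W * (c * c)         ≡⟨ cong (k * k +_) (fourth W c) ⟩
        k * k + 2 * W * c * (2 * W * c)     ≡⟨ cong (λ t → k * k + t * t) k+f ⟨
        k * k + (k + f) * (k + f)           ≡⟨ expand k f ⟩
        2 * (k + f) * k + f * f             ≡⟨ cong (λ t → 2 * t * k + f * f) k+f ⟩
        2 * (2 * W * c) * k + f * f         ≡⟨ cong (λ t → t * k + f * f) (twice W c) ⟩
        4 * W * c * k + f * f               ∎
    by-deficit (no f-large) = far-from-critical n W c (k / c) k f (s≤s (s≤s z≤n)) k+f
      (ℕ.m∸n≤m (2 * W) e) (ℕ.≰⇒> f-large) (≤-quotient W c k W*c≤k) c*p≤k k≤c*[1+p] (size c (k / c) c*p≤k)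
      where
      k≡r+p*c = ℕ.m≡m%n+[m/n]*n k c
      c*p≤k : c * (k / c) ≤ k
      c*p≤k = begin
        c * (k / c)           ≡⟨ ℕ.*-comm c (k / c) ⟩
        k / c * c             ≤⟨ ℕ.m/n*n≤m k c ⟩
        k                     ∎
      k≤c*[1+p] : k ≤ c * suc (k / c)
      k≤c*[1+p] = begin
        k                     ≡⟨ k≡r+p*c ⟩
        k % c + k / c * c     ≤⟨ ℕ.+-monoˡ-≤ (k / c * c) (ℕ.<⇒≤ (ℕ.m%n<n k c)) ⟩
        c + k / c * c         ≡⟨ ℕ.*-comm (suc (k / c)) c ⟩
        c * suc (k / c)       ∎

theorem12 : (m n : ℕ) (H : FinGraph n) (tw g : ℕ) →
    IsTreewidth H tw → IsGridMinorNumber (Star m · ⟦ H ⟧) g →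
    g * g ≤ 4 * (n * suc tw)
theorem12 m n H tw g ((D , width) , _) (M , _) =
  grid-bound n tw g (treewidth-bound-/ D width) size-bound
  where open Totals H M
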